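{- Let $F$ be a recurrent set and let $X\subset F$ be a bifix code of finite $F$-degree $d$. Then for every $w\in F$, $\delta_X(w)=\min\{d,\delta_{K(X)}(w)\}$. In particular, $X$ is determined by its $F$-degree and its kernel.
   Context: $A$ is a finite alphabet. $F\subset A^*$ is recurrent if it is nonempty, closed under factors, and for all $u,w\in F$ there is $v\in F$ with $uvw\in F$. A bifix code is a set of nonempty words none of which is a proper prefix or proper suffix of another. For a set $Y$, a parse of $w$ with respect to $Y$ is a triple $(v,y,u)$ with $w=vyu$, $v\in A^*\setminus A^*Y$, $y\in Y^*$, $u\in A^*\setminus YA^*$; $\delta_Y(w)$ is the number of parses, and $d_F(X)=\max_{w\in F}\delta_X(w)$. The kernel is $K(X)=\{x\in X\mid A^+xA^+\cap X\ne\emptyset\}$. -}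

module Defs where

open import Axiom.ExcludedMiddle using (ExcludedMiddle)
open import Data.List using (List; []; _∷_; _++_; map; concat; filter; length)
open import Data.List.Membership.Propositional using () renaming (_∈_ to _∈ˡ_)
open import Data.List.Membership.Propositional.Properties using (∈-map⁺; ∈-map⁻; ∈-concat⁺′; ∈-filter⁺; ∈-filter⁻)
open import Data.List.Properties using (∷-injectiveʳ)
open import Data.List.Relation.Binary.Disjoint.Propositional using (Disjoint)
open import Data.List.Relation.Unary.All using (All; []; tabulate)
import Data.List.Relation.Unary.All.Properties as All
open import Data.List.Relation.Unary.AllPairs as AllPairs using ([]; _∷_)
import Data.List.Relation.Unary.AllPairs.Properties as AllPairs
open import Data.List.Relation.Unary.Any using (here; there)
open import Data.List.Relation.Unary.Unique.Propositional using (Unique)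
import Data.List.Relation.Unary.Unique.Propositional.Properties as Unique
open import Data.Nat using (ℕ; _≤_)
open import Data.Product using (∃-syntax; _×_; _,_; proj₁; proj₂; map₁)
open import Function using (_⇔_; mk⇔)
open import Level using (0ℓ)
open import Relation.Binary.PropositionalEquality using (_≡_; _≢_; refl; sym; cong; cong₂; trans)
open import Relation.Nullary using (¬_)
open import Relation.Unary using (Pred; _∈_; _∉_)

Word : Set → Set
Word = List

Language : Set → Set₁
Language A = Pred (Word A) 0ℓ

record Recurrent {A : Set} (F : Language A) : Set where
  field
    nonempty      : ∃[ w ] w ∈ F
    factor-closed : ∀ u v w → u ++ v ++ w ∈ F → v ∈ F
    recurrent     : ∀ u w → u ∈ F → w ∈ F → ∃[ v ] v ∈ F × u ++ v ++ w ∈ F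

ProperPrefix ProperSuffix : {A : Set} → Word A → Word A → Set
ProperPrefix x y = ∃[ u ] u ≢ [] × y ≡ x ++ u
ProperSuffix x y = ∃[ u ] u ≢ [] × y ≡ u ++ x

record BifixCode {A : Set} (X : Language A) : Set where
  field
    []∉X           : [] ∉ X
    noProperPrefix : ∀ x y → x ∈ X → y ∈ X → ¬ ProperPrefix x y
    noProperSuffix : ∀ x y → x ∈ X → y ∈ X → ¬ ProperSuffix x y

-- The submonoid Y* generated by Y.
_⋆ : {A : Set} → Language A → Language A
(Y ⋆) w = ∃[ ys ] All Y ys × w ≡ concat ys

-- The ideals A*Y and YA*.
A⋆· : {A : Set} → Language A → Language A
A⋆· Y w = ∃[ p ] ∃[ y ] y ∈ Y × w ≡ p ++ y

_·A⋆ : {A : Set} → Language A → Language A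
(Y ·A⋆) w = ∃[ y ] ∃[ s ] y ∈ Y × w ≡ y ++ s

Kernel : {A : Set} → Language A → Language A
Kernel X x = x ∈ X × ∃[ p ] ∃[ s ] p ≢ [] × s ≢ [] × p ++ x ++ s ∈ X

Triple : Set → Set
Triple A = Word A × Word A × Word A

IsParse : {A : Set} → Language A → Word A → Triple A → Set
IsParse Y w (v , y , u) = w ≡ v ++ y ++ u × v ∉ A⋆· Y × y ∈ Y ⋆ × u ∉ Y ·A⋆

splits : {A : Set} → Word A → List (Word A × Word A)
splits []      = ([] , []) ∷ []
splits (a ∷ w) = ([] , a ∷ w) ∷ map (map₁ (a ∷_)) (splits w)

triplesFrom : {A : Set} → Word A × Word A → List (Triple A)
triplesFrom (v , r) = map (v ,_) (splits r)

factorisations : {A : Set} → Word A → List (Triple A)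
factorisations w = concat (map triplesFrom (splits w))

-- Languages are arbitrary predicates, so being a parse is decided by excluded
-- middle.  By parses-unique and ∈-parses below, this list enumerates the set
-- of parses of w without repetition, so that δ is its cardinality.
parses : {A : Set} → ExcludedMiddle 0ℓ → Language A → Word A → List (Triple A)
parses em Y w = filter (λ t → em {IsParse Y w t}) (factorisations w)

δ : {A : Set} → ExcludedMiddle 0ℓ → Language A → Word A → ℕ
δ em Y w = length (parses em Y w)

-- HasDegree em F X d: the maximum of δ_X over F exists and equals d.
HasDegree : {A : Set} → ExcludedMiddle 0ℓ → Language A → Language A → ℕ → Set
HasDegree em F X d =
  (∃[ w ] w ∈ F × δ em X w ≡ d) × (∀ w → w ∈ F → δ em X w ≤ d)

module _ {A : Set} where

  splits-sound : ∀ (w : Word A) {v r} → (v , r) ∈ˡ splits w → w ≡ v ++ r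
  splits-sound []      (here refl) = refl
  splits-sound (a ∷ w) (here refl) = refl
  splits-sound (a ∷ w) (there p) with ∈-map⁻ (map₁ (a ∷_)) p
  ... | _ , q , refl = cong (a ∷_) (splits-sound w q)

  splits-complete : ∀ (v r : Word A) → (v , r) ∈ˡ splits (v ++ r)
  splits-complete []      []      = here refl
  splits-complete []      (_ ∷ _) = here refl
  splits-complete (a ∷ v) r       = there (∈-map⁺ (map₁ (a ∷_)) (splits-complete v r))

  splits-unique : ∀ (w : Word A) → Unique (splits w)
  splits-unique []      = [] ∷ []
  splits-unique (a ∷ w) = tabulate distinct ∷ Unique.map⁺ injective (splits-unique w)
    where
    distinct : ∀ {s} → s ∈ˡ map (map₁ (a ∷_)) (splits w) → ([] , a ∷ w) ≢ s
    distinct p eq with ∈-map⁻ (map₁ (a ∷_)) p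
    distinct p () | _ , _ , refl

    injective : ∀ {s t : Word A × Word A} → map₁ (a ∷_) s ≡ map₁ (a ∷_) t → s ≡ t
    injective eq = cong₂ _,_ (∷-injectiveʳ (cong proj₁ eq)) (cong proj₂ eq)

  factorisations-complete : ∀ (v y u : Word A) → (v , y , u) ∈ˡ factorisations (v ++ y ++ u)
  factorisations-complete v y u =
    ∈-concat⁺′ (∈-map⁺ (v ,_) (splits-complete y u))
               (∈-map⁺ triplesFrom (splits-complete v (y ++ u)))

  triplesFrom-sound : ∀ (s : Word A × Word A) {v y u} → (v , y , u) ∈ˡ triplesFrom s → s ≡ (v , y ++ u)
  triplesFrom-sound (v , r) p with ∈-map⁻ (v ,_) p
  ... | _ , q , refl = cong (v ,_) (splits-sound r q)

  factorisations-unique : ∀ (w : Word A) → Unique (factorisations w)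
  factorisations-unique w = Unique.concat⁺
    (All.map⁺ (tabulate (λ {s} _ → Unique.map⁺ (cong proj₂) (splits-unique (proj₂ s)))))
    (AllPairs.map⁺ (AllPairs.map disjoint (splits-unique w)))
    where
    disjoint : ∀ {s t : Word A × Word A} → s ≢ t → Disjoint (triplesFrom s) (triplesFrom t)
    disjoint {s} {t} s≢t (p , q) =
      s≢t (trans (triplesFrom-sound s p) (sym (triplesFrom-sound t q)))

  parses-unique : ∀ (em : ExcludedMiddle 0ℓ) (Y : Language A) w → Unique (parses em Y w)
  parses-unique em Y w = Unique.filter⁺ (λ t → em {IsParse Y w t}) (factorisations-unique w)

  ∈-parses : ∀ (em : ExcludedMiddle 0ℓ) (Y : Language A) w t → t ∈ˡ parses em Y w ⇔ IsParse Y w t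
  ∈-parses em Y w (v , y , u) = mk⇔
    (λ p → proj₂ (∈-filter⁻ (λ t → em {IsParse Y w t}) {xs = factorisations w} p))
    (λ { parse@(refl , _) →
      ∈-filter⁺ (λ t → em {IsParse Y w t}) (factorisations-complete v y u) parse })

{-# OPTIONS --safe #-}

-- For a bifix code Y a parse is determined by its first component, so δ_Y(w)
-- counts the prefixes of w outside A*Y.  Hence appending a letter increases
-- δ_Y by one exactly when no word of Y ends there, and δ_Y is monotone for the
-- factor order.  If w ∈ F has δ_X(w) < d, recurrence embeds w into z v w v′ z ∈ F
-- with δ_X(z) = d.  To the right of z every position ends a word of X, whereas
-- counting from the left end of w some position does not; the word of X ending
-- there contains w as an internal factor.  So all words of X \ K(X) have d
-- parses, and δ_X and δ_K(X) agree on every w with δ_X(w) < d.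
module Submission where

open import Defs
open import Axiom.ExcludedMiddle using (ExcludedMiddle)
open import Data.Empty using (⊥-elim)
open import Data.Fin using (Fin)
open import Data.List using (List; []; _∷_; _++_; _∷ʳ_; map; concat; filter; length; initLast; _∷ʳ′_)
open import Data.List.Membership.Propositional using () renaming (_∈_ to _∈ˡ_)
open import Data.List.Membership.Propositional.Properties using (∈-map⁺; ∈-map⁻; ∈-filter⁺; ∈-filter⁻)
open import Data.List.Properties using (++-assoc; ++-identityʳ; ++-cancelˡ; ∷-injective; ∷-injectiveʳ; length-++; length-++-≤ʳ; filter-++; filter-none; map-∘)
open import Data.List.Relation.Unary.All as All using (All; []; _∷_)
open import Data.List.Relation.Unary.AllPairs using (_∷_)
open import Data.List.Relation.Unary.Any using (here; there)
open import Data.List.Relation.Unary.Unique.Propositional using (Unique)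
import Data.List.Relation.Unary.Unique.Propositional.Properties as Unique
open import Data.Nat using (ℕ; suc; _+_; _⊓_; _≤_; _<_; z≤n; s≤s)
open import Data.Nat.ListAction using (sum)
open import Data.Nat.Induction using (<-wellFounded)
open import Data.Nat.Properties using (_≟_; ≤-refl; ≤-reflexive; ≤-trans; ≤-antisym; <-≤-trans; ≤∧≢⇒<; <⇒≱; m≤m+n; m≤n+m; +-mono-≤; +-suc; +-comm; +-assoc; +-identityʳ; +-cancelˡ-≡; n<1+n; m≤n⇒m⊓n≡m; m≥n⇒m⊓n≡n)
open import Data.Product using (∃-syntax; _×_; _,_; proj₁; proj₂)
open import Data.Sum using (_⊎_; inj₁; inj₂)
open import Function using (_∘_)
open import Function.Bundles using (_↔_)
open import Induction.WellFounded using (Acc; acc)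
open import Level using (0ℓ)
open import Relation.Binary.PropositionalEquality using (_≡_; _≢_; refl; sym; trans; cong; cong₂; subst; module ≡-Reasoning)
open import Relation.Nullary using (¬_; Dec; yes; no)
open import Relation.Nullary.Decidable using (decidable-stable)
open import Relation.Unary using (_∈_; _∉_; _⊆_; _≐_)

-- Comparability of factors of a common word.

module _ {A : Set} where

  ++-comparable : ∀ (x s y t : List A) → x ++ s ≡ y ++ t →
                  (∃[ u ] y ≡ x ++ u) ⊎ (∃[ u ] x ≡ y ++ u)
  ++-comparable []      s y       t eq = inj₁ (y , refl)
  ++-comparable (a ∷ x) s []      t eq = inj₂ (a ∷ x , refl)
  ++-comparable (a ∷ x) s (b ∷ y) t eq with ∷-injective eq
  ... | refl , eq′ with ++-comparable x s y t eq′
  ...   | inj₁ (u , p) = inj₁ (u , cong (a ∷_) p)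
  ...   | inj₂ (u , p) = inj₂ (u , cong (a ∷_) p)

  -- The alternatives are asymmetric on purpose: the strict second one later supplies the nonempty
  -- left context of an internal factor.
  suffix-comparable : ∀ (s x t y : List A) → s ++ x ≡ t ++ y →
                      (∃[ u ] x ≡ u ++ y) ⊎ (∃[ u ] u ≢ [] × y ≡ u ++ x)
  suffix-comparable []      x t       y eq = inj₁ (t , eq)
  suffix-comparable (a ∷ s) x []      y eq = inj₂ (a ∷ s , (λ ()) , sym eq)
  suffix-comparable (a ∷ s) x (b ∷ t) y eq = suffix-comparable s x t y (∷-injectiveʳ eq)

  factor-trans : ∀ (p q x s : List A) → (p ++ q ++ x) ++ s ≡ (p ++ q) ++ x ++ s
  factor-trans p q x s = begin
    (p ++ q ++ x) ++ s ≡⟨ cong (_++ s) (++-assoc p q x) ⟨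
    ((p ++ q) ++ x) ++ s ≡⟨ ++-assoc (p ++ q) x s ⟩
    (p ++ q) ++ x ++ s ∎
    where open ≡-Reasoning

length-singleton : ∀ {B : Set} {x : B} {xs : List B} → Unique xs → x ∈ˡ xs →
                   (∀ {y} → y ∈ˡ xs → y ≡ x) → length xs ≡ 1
length-singleton {xs = _ ∷ []}     _                      _ _   = refl
length-singleton {xs = _ ∷ _ ∷ _} ((y≢z All.∷ _) ∷ _) _ all =
  ⊥-elim (y≢z (trans (all (here refl)) (sym (all (there (here refl))))))

-- Unique decoding in bifix codes.

module _ {A : Set} {Y : Language A} (Y-bifix : BifixCode Y) where
  open BifixCode Y-bifix

  prefix-unique : ∀ {y y′} s s′ → y ∈ Y → y′ ∈ Y → y ++ s ≡ y′ ++ s′ → y ≡ y′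
  prefix-unique {y} {y′} s s′ y∈Y y′∈Y eq with ++-comparable y s y′ s′ eq
  ... | inj₁ ([]    , p) = sym (trans p (++-identityʳ y))
  ... | inj₁ (a ∷ u , p) = ⊥-elim (noProperPrefix y y′ y∈Y y′∈Y (a ∷ u , (λ ()) , p))
  ... | inj₂ ([]    , p) = trans p (++-identityʳ y′)
  ... | inj₂ (a ∷ u , p) = ⊥-elim (noProperPrefix y′ y y′∈Y y∈Y (a ∷ u , (λ ()) , p))

  []∉A⋆· : [] ∉ A⋆· Y
  []∉A⋆· ([] , [] , []∈Y , refl) = []∉X []∈Y

  -- If both lists are nonempty, their heads agree because `Y` is a prefix code, and they cancel. If
  -- only one is exhausted, its remainder would begin with a word of `Y`.
  greedy-unique : ∀ {ys zs} u v → All Y ys → All Y zs → u ∉ Y ·A⋆ → v ∉ Y ·A⋆ →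
                  concat ys ++ u ≡ concat zs ++ v → concat ys ≡ concat zs × u ≡ v
  greedy-unique u v [] [] _ _ eq = refl , eq
  greedy-unique {zs = z ∷ zs} u v [] (z∈Y ∷ _) u∉ _ eq =
    ⊥-elim (u∉ (z , concat zs ++ v , z∈Y , trans eq (++-assoc z (concat zs) v)))
  greedy-unique {ys = y ∷ ys} u v (y∈Y ∷ _) [] _ v∉ eq =
    ⊥-elim (v∉ (y , concat ys ++ u , y∈Y , trans (sym eq) (++-assoc y (concat ys) u)))
  greedy-unique {y ∷ ys} {z ∷ zs} u v (y∈Y ∷ ys∈Y) (z∈Y ∷ zs∈Y) u∉ v∉ eq
    with trans (sym (++-assoc y (concat ys) u)) (trans eq (++-assoc z (concat zs) v))
  ... | eq′ with prefix-unique (concat ys ++ u) (concat zs ++ v) y∈Y z∈Y eq′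
  ...   | refl with greedy-unique u v ys∈Y zs∈Y u∉ v∉ (++-cancelˡ y _ _ eq′)
  ...     | p , q = cong (y ++_) p , q

Kernel-bifix : ∀ {A : Set} {X : Language A} → BifixCode X → BifixCode (Kernel X)
Kernel-bifix X-bifix = record
  { []∉X           = []∉X ∘ proj₁
  ; noProperPrefix = λ x y x∈K y∈K → noProperPrefix x y (proj₁ x∈K) (proj₁ y∈K)
  ; noProperSuffix = λ x y x∈K y∈K → noProperSuffix x y (proj₁ x∈K) (proj₁ y∈K)
  }
  where open BifixCode X-bifix

-- Counting prefixes with a classical indicator.

module _ (em : ExcludedMiddle 0ℓ) where

  indicator : ∀ {P : Set} → Dec P → ℕ
  indicator (yes _) = 1
  indicator (no  _) = 0

  χ : Set → ℕ
  χ P = indicator (em {P})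

  χ-yes : ∀ {P : Set} → P → χ P ≡ 1
  χ-yes {P} p with em {P}
  ... | yes _ = refl
  ... | no ¬p = ⊥-elim (¬p p)

  χ-no : ∀ {P : Set} → ¬ P → χ P ≡ 0
  χ-no {P} ¬p with em {P}
  ... | yes p = ⊥-elim (¬p p)
  ... | no  _ = refl

  χ≤1 : ∀ (P : Set) → χ P ≤ 1
  χ≤1 P with em {P}
  ... | yes _ = ≤-refl
  ... | no  _ = z≤n

  χ-mono : ∀ {P Q : Set} → (P → Q) → χ P ≤ χ Q
  χ-mono {P} f with em {P}
  ... | yes p = ≤-reflexive (sym (χ-yes (f p)))
  ... | no  _ = z≤n

  module _ {A : Set} where

    -- Shifting the predicate by the letter read makes the comparison of `w` with `a ∷ w` hold by
    -- computation.
    countPrefixes : Language A → Word A → ℕ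
    countPrefixes P []      = χ (P [])
    countPrefixes P (a ∷ w) = χ (P []) + countPrefixes (P ∘ (a ∷_)) w

    countPrefixes-∷ʳ : ∀ (P : Language A) w a →
      countPrefixes P (w ∷ʳ a) ≡ countPrefixes P w + χ (P (w ∷ʳ a))
    countPrefixes-∷ʳ P []      a = refl
    countPrefixes-∷ʳ P (b ∷ w) a =
      trans (cong (χ (P []) +_) (countPrefixes-∷ʳ (P ∘ (b ∷_)) w a))
            (sym (+-assoc (χ (P [])) _ _))

    countPrefixes-mono : ∀ (P Q : Language A) w →
      (∀ v r → w ≡ v ++ r → P v → Q v) → countPrefixes P w ≤ countPrefixes Q w
    countPrefixes-mono P Q []      f = χ-mono (f [] [] refl)
    countPrefixes-mono P Q (a ∷ w) f = +-mono-≤ (χ-mono (f [] (a ∷ w) refl))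
      (countPrefixes-mono _ _ w λ v r eq → f (a ∷ v) r (cong (a ∷_) eq))

    -- The exceptional set `E` is prefix-free, so at most one prefix of `w` lies in it; this one
    -- accounts for the `suc`.
    countPrefixes-mono-upto1 : ∀ (P Q E : Language A) w →
      (∀ v → P v → Q v ⊎ E v) → (∀ v s → E v → E (v ++ s) → s ≡ []) →
      countPrefixes P w ≤ suc (countPrefixes Q w)
    countPrefixes-mono-upto1 P Q E []      _ _ = ≤-trans (χ≤1 (P [])) (s≤s z≤n)
    countPrefixes-mono-upto1 P Q E (a ∷ w) f E-single with em {E []}
    -- The only exception is the empty prefix: its term is bounded by 1, and on all longer prefixes
    -- `P` implies `Q`.
    ... | yes E[] = +-mono-≤ (χ≤1 (P []))
          (≤-trans (countPrefixes-mono _ _ w λ v _ _ → PQ v) (m≤n+m _ (χ (Q []))))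
      where
      PQ : ∀ v → P (a ∷ v) → Q (a ∷ v)
      PQ v Pav with f (a ∷ v) Pav
      ... | inj₁ Qav = Qav
      ... | inj₂ Eav with E-single [] (a ∷ v) E[] Eav
      ...   | ()
    ... | no ¬E[] = ≤-trans
          (+-mono-≤ (χ-mono PQ)
            (countPrefixes-mono-upto1 _ _ (E ∘ (a ∷_)) w (f ∘ (a ∷_)) (E-single ∘ (a ∷_))))
          (≤-reflexive (+-suc (χ (Q [])) _))
      where
      PQ : P [] → Q []
      PQ P[] with f [] P[]
      ... | inj₁ Q[] = Q[]
      ... | inj₂ E[] = ⊥-elim (¬E[] E[])

    countPrefixes-splits : ∀ (P : Language A) w →
      sum (map (χ ∘ P ∘ proj₁) (splits w)) ≡ countPrefixes P w
    countPrefixes-splits P []      = +-identityʳ _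
    countPrefixes-splits P (a ∷ w) = cong (χ (P []) +_)
      (trans (cong sum (sym (map-∘ (splits w)))) (countPrefixes-splits (P ∘ (a ∷_)) w))

  -- The number of parses for a bifix code, and its monotonicity.

  module _ {A : Set} {Y : Language A} (Y-bifix : BifixCode Y) where
    open BifixCode Y-bifix

    -- Words of `Y` are stripped from the left as long as possible; they are nonempty, so the length
    -- decreases.
    greedy : ∀ w → ∃[ y ] ∃[ u ] w ≡ y ++ u × y ∈ Y ⋆ × u ∉ Y ·A⋆
    greedy w = go w (<-wellFounded _)
      where
      go : ∀ w → Acc _<_ (length w) → ∃[ y ] ∃[ u ] w ≡ y ++ u × y ∈ Y ⋆ × u ∉ Y ·A⋆
      go w (acc rec) with em {w ∈ Y ·A⋆}
      ... | no w∉ = [] , w , refl , ([] , [] , refl) , w∉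
      ... | yes ([] , s , []∈Y , eq) = ⊥-elim ([]∉X []∈Y)
      ... | yes (a ∷ x , s , ax∈Y , refl) with go s (rec (s≤s (length-++-≤ʳ s {xs = x})))
      ...   | _ , u , refl , (ys , ys∈Y , refl) , u∉ =
                concat ((a ∷ x) ∷ ys) , u , sym (++-assoc (a ∷ x) (concat ys) u)
                , ((a ∷ x) ∷ ys , ax∈Y ∷ ys∈Y , refl) , u∉

    -- Decoding `r` greedily is possible in exactly one way, so only the condition on `v` decides
    -- between one parse and none.
    parses-from-split : ∀ v r →
      length (filter (λ t → em {IsParse Y (v ++ r) t}) (triplesFrom (v , r))) ≡ χ (v ∉ A⋆· Y)
    parses-from-split v r with em {v ∉ A⋆· Y}
    ... | no v∈ = cong length (filter-none parse? (All.tabulate none))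
      where
      parse? : ∀ t → Dec (IsParse Y (v ++ r) t)
      parse? t = em
      none : ∀ {t} → t ∈ˡ triplesFrom (v , r) → ¬ IsParse Y (v ++ r) t
      none t∈ parse with ∈-map⁻ (v ,_) t∈
      ... | _ , _ , refl = v∈ (proj₁ (proj₂ parse))
    ... | yes v∉ with greedy r
    ...   | y , u , refl , y∈@(_ , ys∈ , refl) , u∉ = length-singleton
            (Unique.filter⁺ parse? (Unique.map⁺ (cong proj₂) (splits-unique (y ++ u))))
            (∈-filter⁺ parse? (∈-map⁺ (v ,_) (splits-complete y u)) (refl , v∉ , y∈ , u∉))
            (λ t∈ → only (∈-filter⁻ parse? {xs = triplesFrom (v , y ++ u)} t∈))
      where
      parse? : ∀ t → Dec (IsParse Y (v ++ y ++ u) t)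
      parse? t = em
      only : ∀ {t} → t ∈ˡ triplesFrom (v , y ++ u) × IsParse Y (v ++ y ++ u) t → t ≡ (v , y , u)
      only (t∈ , parse) with ∈-map⁻ (v ,_) t∈
      only (t∈ , eq , _ , (_ , zs∈ , refl) , u′∉) | (_ , u′) , _ , refl
        with greedy-unique Y-bifix u u′ ys∈ zs∈ u∉ u′∉ (++-cancelˡ v _ _ eq)
      ... | p , q = cong (v ,_) (cong₂ _,_ (sym p) (sym q))

    δ≡countPrefixes : ∀ w → δ em Y w ≡ countPrefixes (_∉ A⋆· Y) w
    δ≡countPrefixes w =
      trans (go (splits w) (All.tabulate (splits-sound w))) (countPrefixes-splits _ w)
      where
      parse? : ∀ t → Dec (IsParse Y w t)
      parse? t = em
      -- The list of splittings is generalised so that the induction runs over it while `w` stays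
      -- fixed.
      go : ∀ ss → All (λ s → w ≡ proj₁ s ++ proj₂ s) ss →
           length (filter parse? (concat (map triplesFrom ss))) ≡
           sum (map (λ s → χ (proj₁ s ∉ A⋆· Y)) ss)
      go []             []         = refl
      go ((v , r) ∷ ss) (eq ∷ eqs) = begin
        length (filter parse? (triplesFrom (v , r) ++ concat (map triplesFrom ss)))
          ≡⟨ cong length (filter-++ parse? (triplesFrom (v , r)) _) ⟩
        length (filter parse? (triplesFrom (v , r)) ++ filter parse? (concat (map triplesFrom ss)))
          ≡⟨ length-++ (filter parse? (triplesFrom (v , r))) ⟩
        length (filter parse? (triplesFrom (v , r))) + length (filter parse? (concat (map triplesFrom ss)))
          ≡⟨ cong₂ _+_ (head eq) (go ss eqs) ⟩
        χ (v ∉ A⋆· Y) + sum (map (λ s → χ (proj₁ s ∉ A⋆· Y)) ss) ∎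
        where
        open ≡-Reasoning
        head : w ≡ v ++ r → length (filter parse? (triplesFrom (v , r))) ≡ χ (v ∉ A⋆· Y)
        head refl = parses-from-split v r

    δ-∷ʳ : ∀ w a → δ em Y (w ∷ʳ a) ≡ δ em Y w + χ (w ∷ʳ a ∉ A⋆· Y)
    δ-∷ʳ w a = begin
      δ em Y (w ∷ʳ a)                                     ≡⟨ δ≡countPrefixes (w ∷ʳ a) ⟩
      countPrefixes (_∉ A⋆· Y) (w ∷ʳ a)                   ≡⟨ countPrefixes-∷ʳ _ w a ⟩
      countPrefixes (_∉ A⋆· Y) w + χ (w ∷ʳ a ∉ A⋆· Y)     ≡⟨ cong (_+ χ (w ∷ʳ a ∉ A⋆· Y)) (δ≡countPrefixes w) ⟨
      δ em Y w + χ (w ∷ʳ a ∉ A⋆· Y)                       ∎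
      where open ≡-Reasoning

    δ-++ʳ : ∀ w s → δ em Y w ≤ δ em Y (w ++ s)
    δ-++ʳ w []      = ≤-reflexive (cong (δ em Y) (sym (++-identityʳ w)))
    δ-++ʳ w (a ∷ s) = ≤-trans (m≤m+n (δ em Y w) _) (≤-trans (≤-reflexive (sym (δ-∷ʳ w a)))
      (≤-trans (δ-++ʳ (w ∷ʳ a) s) (≤-reflexive (cong (δ em Y) (++-assoc w (a ∷ []) s)))))

    -- If v ∉ A*Y but av ∈ A*Y then av ∈ Y.  At most one prefix av of aw lies in
    -- Y, and this loss is compensated by the new empty prefix.
    δ-∷ : ∀ a w → δ em Y w ≤ δ em Y (a ∷ w)
    δ-∷ a w = ≤-trans (≤-reflexive (δ≡countPrefixes w))
      (≤-trans (countPrefixes-mono-upto1 (_∉ A⋆· Y) (λ v → a ∷ v ∉ A⋆· Y) (λ v → a ∷ v ∈ Y) w lost single)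
      (≤-reflexive (trans (cong (_+ countPrefixes (λ v → a ∷ v ∉ A⋆· Y) w) (sym (χ-yes ([]∉A⋆· Y-bifix))))
                          (sym (δ≡countPrefixes (a ∷ w))))))
      where
      lost : ∀ v → v ∉ A⋆· Y → (a ∷ v ∉ A⋆· Y) ⊎ (a ∷ v ∈ Y)
      lost v v∉ with em {a ∷ v ∈ Y}
      ... | yes av∈Y = inj₂ av∈Y
      ... | no  av∉Y = inj₁ λ
        { ([]    , y , y∈Y , refl) → av∉Y y∈Y
        ; (_ ∷ p , y , y∈Y , refl) → v∉ (p , y , y∈Y , refl) }
      single : ∀ v s → a ∷ v ∈ Y → a ∷ v ++ s ∈ Y → s ≡ []
      single v []      _    _     = refl
      single v (b ∷ s) av∈Y avs∈Y =
        ⊥-elim (noProperPrefix (a ∷ v) (a ∷ v ++ b ∷ s) av∈Y avs∈Y (b ∷ s , (λ ()) , refl))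

    δ-++ˡ : ∀ p w → δ em Y w ≤ δ em Y (p ++ w)
    δ-++ˡ []      w = ≤-refl
    δ-++ˡ (a ∷ p) w = ≤-trans (δ-++ˡ p w) (δ-∷ a (p ++ w))

    δ-factor : ∀ p w s → δ em Y w ≤ δ em Y (p ++ w ++ s)
    δ-factor p w s = ≤-trans (δ-++ʳ w s) (δ-++ˡ p (w ++ s))

  -- A smaller code excludes fewer prefixes. The inclusion is asked only for factors of `w`, which
  -- allows a comparison of `X` with its kernel on words with few parses.
  δ-anti : ∀ {A : Set} {Y Z : Language A} → BifixCode Y → BifixCode Z → ∀ w →
           (∀ p x s → w ≡ p ++ x ++ s → x ∈ Y → x ∈ Z) → δ em Z w ≤ δ em Y w
  δ-anti Y-bifix Z-bifix w Y⊆Z = ≤-trans (≤-reflexive (δ≡countPrefixes Z-bifix w))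
    (≤-trans (countPrefixes-mono _ _ w λ
       { _ r eq v∉ (p , y , y∈Y , refl) → v∉ (p , y , Y⊆Z p y r (trans eq (++-assoc p y r)) y∈Y , refl) })
    (≤-reflexive (sym (δ≡countPrefixes Y-bifix w))))

  -- Words with fewer than d parses, and the formula for the kernel.

  module _ {A : Set} {F : Language A} (F-recurrent : Recurrent F)
           {X : Language A} (X-bifix : BifixCode X) where
    open Recurrent F-recurrent

    prefix-closed : ∀ {u} s → u ++ s ∈ F → u ∈ F
    prefix-closed s = factor-closed [] _ s

    module _ {d : ℕ} (degree : HasDegree em F X d) where

      -- Letters move from `s` to `u` until one raises the count of `u`. The count of `t ++ u` is
      -- already maximal, so a word of `X` ends at that letter, and it must start inside `t`.
      internal-in-extension : ∀ t u s → t ++ u ++ s ∈ F → d ≤ δ em X (t ++ u) →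
        δ em X u < δ em X (u ++ s) → ∃[ p ] ∃[ q ] p ≢ [] × q ≢ [] × p ++ u ++ q ∈ X
      internal-in-extension t u [] _ _ lt =
        ⊥-elim (<⇒≱ lt (≤-reflexive (cong (δ em X) (++-identityʳ u))))
      internal-in-extension t u (c ∷ s) tus∈F d≤ lt with em {u ∷ʳ c ∉ A⋆· X}
      -- The letter `c` leaves the count of `u` unchanged and is absorbed; it later rejoins the
      -- right context.
      ... | no ¬uc∉ with internal-in-extension t (u ∷ʳ c) s
              (subst F (cong (t ++_) (sym (++-assoc u (c ∷ []) s))) tus∈F)
              (≤-trans d≤ (≤-trans (δ-++ʳ X-bifix (t ++ u) (c ∷ [])) (≤-reflexive (cong (δ em X) (++-assoc t u (c ∷ []))))))
              (≤-trans (s≤s (≤-reflexive (trans (δ-∷ʳ X-bifix u c) (trans (cong (δ em X u +_) (χ-no ¬uc∉)) (+-identityʳ _)))))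
                (≤-trans lt (≤-reflexive (cong (δ em X) (sym (++-assoc u (c ∷ []) s))))))
      ...   | p , q , p≢[] , _ , pucq∈X =
              p , c ∷ q , p≢[] , (λ ()) , subst X (cong (p ++_) (++-assoc u (c ∷ []) q)) pucq∈X
      internal-in-extension t u (c ∷ s) tus∈F d≤ lt | yes uc∉ with em {(t ++ u) ∷ʳ c ∉ A⋆· X}
      -- Here `c` would give a word of `F` with more than d parses.
      ... | yes tuc∉ = ⊥-elim (<⇒≱ (n<1+n d) (≤-trans
              (≤-trans (s≤s d≤) (≤-reflexive (trans (+-comm 1 _)
                (trans (cong (δ em X (t ++ u) +_) (sym (χ-yes tuc∉))) (sym (δ-∷ʳ X-bifix (t ++ u) c))))))
              (proj₂ degree _ (prefix-closed s (subst F assoc tus∈F)))))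
        where
        assoc : t ++ u ++ c ∷ s ≡ ((t ++ u) ∷ʳ c) ++ s
        assoc = trans (sym (++-assoc t u (c ∷ s))) (sym (++-assoc (t ++ u) (c ∷ []) s))
      ... | no ¬tuc∉ with decidable-stable em ¬tuc∉
      ...   | p , y , y∈X , eq with suffix-comparable t (u ∷ʳ c) p y (trans (sym (++-assoc t u (c ∷ []))) eq)
      ...     | inj₁ (q , uc≡)       = ⊥-elim (uc∉ (q , y , y∈X , uc≡))
      -- The word of `X` ending at `c` overhangs `u` by `q` on the left and by `c` on the right.
      ...     | inj₂ (q , q≢[] , y≡) = q , c ∷ [] , q≢[] , (λ ()) , subst X y≡ y∈X

      internal-factor : ∀ w → w ∈ F → δ em X w < d →
                        ∃[ p ] ∃[ s ] p ≢ [] × s ≢ [] × p ++ w ++ s ∈ X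
      internal-factor w w∈F lt with proj₁ degree
      ... | z , z∈F , refl with recurrent z w z∈F w∈F
      ...   | v , _ , zvw∈F with recurrent (z ++ v ++ w) z zvw∈F z∈F
      -- The left copy of `z` makes the count maximal before `w` ends; the right copy forces the
      -- count started at `w` to grow.
      ...     | v′ , _ , zvwvz∈F = internal-in-extension (z ++ v) w (v′ ++ z)
                (subst F (factor-trans z v w (v′ ++ z)) zvwvz∈F)
                (≤-trans (δ-++ʳ X-bifix z (v ++ w)) (≤-reflexive (cong (δ em X) (sym (++-assoc z v w)))))
                (<-≤-trans lt (≤-trans (δ-++ˡ X-bifix (w ++ v′) z) (≤-reflexive (cong (δ em X) (++-assoc w v′ z)))))

      δ-kernel : ∀ w → w ∈ F → δ em X w ≡ d ⊓ δ em (Kernel X) w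
      δ-kernel w w∈F with δ em X w ≟ d
      -- The kernel lies in `X`, so it gives at least d parses and the minimum is d.
      ... | yes refl = sym (m≤n⇒m⊓n≡m (δ-anti (Kernel-bifix X-bifix) X-bifix w λ _ _ _ _ → proj₁))
      ... | no  δ≢d = trans δX≡δK (sym (m≥n⇒m⊓n≡n (subst (_≤ d) δX≡δK δ≤d)))
        where
        δ≤d = proj₂ degree w w∈F
        -- A factor of `w` has at most as many parses as `w`, hence fewer than d, so it is internal
        -- to a word of `X`.
        X⊆K : ∀ p x s → w ≡ p ++ x ++ s → x ∈ X → x ∈ Kernel X
        X⊆K p x s refl x∈X = x∈X , internal-factor x (factor-closed p x s w∈F)
          (≤-trans (s≤s (δ-factor X-bifix p x s)) (≤∧≢⇒< δ≤d δ≢d))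
        δX≡δK : δ em X w ≡ δ em (Kernel X) w
        δX≡δK = ≤-antisym
          (δ-anti (Kernel-bifix X-bifix) X-bifix w λ _ _ _ _ → proj₁)
          (δ-anti X-bifix (Kernel-bifix X-bifix) w X⊆K)

  -- Recovering the code from its parse counts.

  module _ {A : Set} {F : Language A} (F-recurrent : Recurrent F)
           {X Z : Language A} (X-bifix : BifixCode X) (Z-bifix : BifixCode Z)
           (δ≡ : ∀ w → w ∈ F → δ em X w ≡ δ em Z w) where
    open Recurrent F-recurrent

    -- Whether a word of the code ends at the last letter of `x` is read off from the increment of δ
    -- at that letter; both counts concern words of `F`.
    A⋆·-determined : ∀ x → x ∈ F → x ∈ A⋆· X → x ∈ A⋆· Z
    A⋆·-determined x x∈F x∈ with initLast x
    ... | []       = ⊥-elim ([]∉A⋆· X-bifix x∈)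
    ... | w ∷ʳ′ a = decidable-stable em λ wa∉ → 0≢1 (begin
      0                       ≡⟨ χ-no (λ ∉X → ∉X x∈) ⟨
      χ (w ∷ʳ a ∉ A⋆· X)      ≡⟨ +-cancelˡ-≡ (δ em X w) _ _ step ⟩
      χ (w ∷ʳ a ∉ A⋆· Z)      ≡⟨ χ-yes wa∉ ⟩
      1                       ∎)
      where
      open ≡-Reasoning
      0≢1 : 0 ≢ 1
      0≢1 ()
      step : δ em X w + χ (w ∷ʳ a ∉ A⋆· X) ≡ δ em X w + χ (w ∷ʳ a ∉ A⋆· Z)
      step = begin
        δ em X w + χ (w ∷ʳ a ∉ A⋆· X) ≡⟨ δ-∷ʳ X-bifix w a ⟨
        δ em X (w ∷ʳ a)               ≡⟨ δ≡ (w ∷ʳ a) x∈F ⟩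
        δ em Z (w ∷ʳ a)               ≡⟨ δ-∷ʳ Z-bifix w a ⟩
        δ em Z w + χ (w ∷ʳ a ∉ A⋆· Z) ≡⟨ cong (_+ χ (w ∷ʳ a ∉ A⋆· Z)) (δ≡ w (factor-closed [] w (a ∷ []) x∈F)) ⟨
        δ em X w + χ (w ∷ʳ a ∉ A⋆· Z) ∎

  -- x ∈ X ends with some y ∈ Z, which ends with some z ∈ X; as X is a suffix
  -- code, x = z and hence x = y.
  δ-determines : ∀ {A : Set} {F : Language A} → Recurrent F →
    ∀ {X Z : Language A} → X ⊆ F → Z ⊆ F → BifixCode X → BifixCode Z →
    (∀ w → w ∈ F → δ em X w ≡ δ em Z w) → X ⊆ Z
  δ-determines F-recurrent {X} {Z} X⊆F Z⊆F X-bifix Z-bifix δ≡ {x} x∈X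
    with A⋆·-determined F-recurrent X-bifix Z-bifix δ≡ x (X⊆F x∈X) ([] , x , x∈X , refl)
  ... | [] , _ , y∈Z , refl = y∈Z
  ... | a ∷ p , y , y∈Z , refl
    with A⋆·-determined F-recurrent Z-bifix X-bifix (λ w w∈F → sym (δ≡ w w∈F)) y (Z⊆F y∈Z) ([] , y , y∈Z , refl)
  ... | q , z , z∈X , refl = ⊥-elim (BifixCode.noProperSuffix X-bifix z _ z∈X x∈X
          (a ∷ p ++ q , (λ ()) , cong (a ∷_) (sym (++-assoc p q z))))

mainTheorem7 : (em : ExcludedMiddle 0ℓ) →
    (A : Set) (k : ℕ) → A ↔ Fin k →
    (F : Language A) → Recurrent F →
    (X : Language A) → X ⊆ F → BifixCode X →
    (d : ℕ) → HasDegree em F X d →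
    (∀ w → w ∈ F → δ em X w ≡ d ⊓ δ em (Kernel X) w)
    × (∀ (X′ : Language A) → X′ ⊆ F → BifixCode X′ → HasDegree em F X′ d →
    Kernel X ≐ Kernel X′ → X ≐ X′)
mainTheorem7 em A k _ F F-recurrent X X⊆F X-bifix d degree =
  δ-kernel em F-recurrent X-bifix degree , λ X′ X′⊆F X′-bifix degree′ (K⊆K′ , K′⊆K) →
    -- Equal kernels have equal parse counts; with the common d the formula then makes the counts of
    -- `X` and `X′` agree on `F`.
    let δK≡δK′ : ∀ w → δ em (Kernel X) w ≡ δ em (Kernel X′) w
        δK≡δK′ w = ≤-antisym
          (δ-anti em (Kernel-bifix X′-bifix) (Kernel-bifix X-bifix) w λ _ _ _ _ → K′⊆K)
          (δ-anti em (Kernel-bifix X-bifix) (Kernel-bifix X′-bifix) w λ _ _ _ _ → K⊆K′)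
        δ≡ : ∀ w → w ∈ F → δ em X w ≡ δ em X′ w
        δ≡ w w∈F = trans (δ-kernel em F-recurrent X-bifix degree w w∈F)
          (trans (cong (d ⊓_) (δK≡δK′ w)) (sym (δ-kernel em F-recurrent X′-bifix degree′ w w∈F)))
    in δ-determines em F-recurrent X⊆F X′⊆F X-bifix X′-bifix δ≡
     , δ-determines em F-recurrent X′⊆F X⊆F X′-bifix X-bifix λ w w∈F → sym (δ≡ w w∈F)
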